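{- Let $\mathfrak u=(a_0,a_1,\dots)$ be a (finite or infinite) sequence of non-negative integers such that $\Upsilon^{(6)}(\mathfrak u)=\mathfrak u$. Then $\mathfrak u$ has at most one champion.
   Context: For a finite or infinite sequence $\mathfrak u=(a_0,a_1,\dots)$ of non-negative integers, the P-G triangle generated by $\mathfrak u$ consists of the numbers $d_k^{(j)}$ defined by $d_k^{(0)}=a_k$ and $d_k^{(j+1)}=|d_{k+1}^{(j)}-d_k^{(j)}|$ for $j,k\ge 0$ (for a finite sequence $(a_0,\dots,a_{N-1})$, for $0\le k\le N-1-j$). The operator $\Upsilon$ sends $\mathfrak u$ to the left edge $(d_0^{(0)},d_0^{(1)},d_0^{(2)},\dots)$ of its P-G triangle (a sequence of the same length as $\mathfrak u$); $\Upsilon^{(n)}$ denotes its $n$-th iterate. The term $a_n$ ($n\ge0$) is a champion of $\mathfrak u$ if $a_n>0$ and $a_j<a_n$ for all $0\le j<n$. -}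

module Defs where

open import Data.Nat.Base using (ℕ; zero; suc; _+_; _<_; ∣_-_∣)
open import Data.Nat.Properties using (<-trans; n<1+n; +-identityʳ; +-suc)
open import Data.Nat.GeneralisedArithmetic using (fold)
open import Data.Product.Base using (_×_)
open import Relation.Binary.Construct.Add.Supremum.Strict _<_ using (_<⁺_; [_]; <⁺-trans)
open import Relation.Binary.PropositionalEquality using (_≡_; subst)
open import Relation.Nullary.Construct.Add.Supremum using (_⁺; [_])

-- A length is [ N ] (a finite sequence a₀ … a_{N-1}) or ⊤⁺ (an infinite one).
Length : Set
Length = ℕ ⁺

infix 4 _<ᴸ_

_<ᴸ_ : ℕ → Length → Set
k <ᴸ L = [ k ] <⁺ L

-- The bound is irrelevant, so a term depends on its index alone.
Sequence : Length → Set
Sequence L = (k : ℕ) → .(k <ᴸ L) → ℕ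

-- Termwise equality: function extensionality is not available.
infix 4 _≈_

_≈_ : {L : Length} → Sequence L → Sequence L → Set
_≈_ {L} u v = (k : ℕ) .(k<L : k <ᴸ L) → u k k<L ≡ v k k<L

private
  upper-left : ∀ {L} k j → k + suc j <ᴸ L → k + j <ᴸ L
  upper-left {L} k j p =
    <⁺-trans <-trans [ n<1+n (k + j) ] (subst (_<ᴸ L) (+-suc k j) p)

  upper-right : ∀ {L} k j → k + suc j <ᴸ L → suc k + j <ᴸ L
  upper-right {L} k j = subst (_<ᴸ L) (+-suc k j)

-- d u j k is d_k^{(j)}; for length N the bound says k ≤ N - 1 - j.
d : {L : Length} → Sequence L → (j k : ℕ) → .(k + j <ᴸ L) → ℕ
d u zero    k p = u k (subst (_<ᴸ _) (+-identityʳ k) p)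
d u (suc j) k p =
  ∣ d u j (suc k) (upper-right k j p) - d u j k (upper-left k j p) ∣

Υ : {L : Length} → Sequence L → Sequence L
Υ u j j<L = d u j 0 j<L

Υ^ : {L : Length} → ℕ → Sequence L → Sequence L
Υ^ n u = fold u Υ n

Champion : {L : Length} → Sequence L → (n : ℕ) → .(n <ᴸ L) → Set
Champion {L} u n n<L =
  0 < u n n<L × (∀ j .(j<L : j <ᴸ L) → j < n → u j j<L < u n n<L)

AtMostOneChampion : {L : Length} → Sequence L → Set
AtMostOneChampion {L} u =
  ∀ m n .(m<L : m <ᴸ L) .(n<L : n <ᴸ L) →
  Champion u m m<L → Champion u n n<L → m ≡ n

{-# OPTIONS --safe #-}

-- An entry of the triangle is at most the largest term below it, so applying Υ never
-- raises a prefix maximum. If u is periodic and a champion c sits at position n, all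
-- terms of Υ u before n are below c, hence (Υ u)ₙ = c: otherwise the prefix maximum
-- at n would have dropped below c for good. As the terms of u before n are below c,
-- the difference d₀⁽ⁿ⁾ can only reach c if d₁⁽ⁿ⁻¹⁾ = c and d₀⁽ⁿ⁻¹⁾ = 0; descending
-- along the right edge, this forces every term of u before n to vanish.
module Submission where

open import Defs
open import Data.Empty using (⊥-elim)
open import Data.Nat.Base
open import Data.Nat.Properties
open import Data.Product.Base using (_×_; _,_)
open import Data.Sum.Base using (_⊎_; inj₁; inj₂)
open import Relation.Binary.Construct.Add.Supremum.Strict _<_ using ([_]; <⁺-trans)
open import Relation.Binary.Definitions using (tri<; tri≈; tri>)
open import Relation.Binary.PropositionalEquality
open import Relation.Nullary.Negation using (¬_; contradiction)

∣-∣-< : ∀ {c} x y → x < c → y < c → ∣ x - y ∣ < c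
∣-∣-< x y x<c y<c = ≤-<-trans (∣m-n∣≤m⊔n x y) (⊔-lub x<c y<c)

-- If `x ≤ y`, the difference is at most `y`, hence below `c`. Otherwise `c ≤ x ∸ y` with `x ≤ c`
-- leaves no room for a positive `y`.
∣-∣-extremal : ∀ {c} x y → x ≤ c → y < c → c ≤ ∣ x - y ∣ → c ≤ x × y ≡ 0
∣-∣-extremal {c} x y x≤c y<c c≤∣x-y∣ with ≤-total x y
... | inj₁ x≤y = contradiction
  (≤-trans (subst (c ≤_) (m≤n⇒∣m-n∣≡n∸m x≤y) c≤∣x-y∣) (m∸n≤m y x)) (<⇒≱ y<c)
... | inj₂ y≤x = ≤-trans c≤x∸y (m∸n≤m x y) , n≤0⇒n≡0 (+-cancelˡ-≤ c y 0 c+y≤c+0)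
  where
  c≤x∸y : c ≤ x ∸ y
  c≤x∸y = subst (c ≤_) (m≤n⇒∣n-m∣≡n∸m y≤x) c≤∣x-y∣

  c+y≤c+0 : c + y ≤ c + 0
  c+y≤c+0 = begin
    c + y      ≤⟨ +-monoˡ-≤ y c≤x∸y ⟩
    x ∸ y + y  ≡⟨ m∸n+n≡m y≤x ⟩
    x          ≤⟨ x≤c ⟩
    c          ≡⟨ +-identityʳ c ⟨
    c + 0      ∎
    where open ≤-Reasoning

module _ {L : Length} where

  <ᴸ-trans : ∀ {i n} → i < n → n <ᴸ L → i <ᴸ L
  <ᴸ-trans i<n = <⁺-trans <-trans [ i<n ]

  <ᴸ-left : ∀ k j → k + suc j <ᴸ L → k + j <ᴸ L
  <ᴸ-left k j = <ᴸ-trans (+-monoʳ-< k (n<1+n j))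

  <ᴸ-right : ∀ k j → k + suc j <ᴸ L → suc k + j <ᴸ L
  <ᴸ-right k j = subst (_<ᴸ L) (+-suc k j)

  -- The window is half-open, so it contains every term beneath `d u j k` as soon as `k + j < l`. A
  -- bound "at most `c`" is written with `suc c`.
  AllBelow : Sequence L → (c k l : ℕ) → Set
  AllBelow u c k l = ∀ i .(i<L : i <ᴸ L) → k ≤ i → i < l → u i i<L < c

  AllZero : Sequence L → (k l : ℕ) → Set
  AllZero u k l = ∀ i .(i<L : i <ᴸ L) → k ≤ i → i < l → u i i<L ≡ 0

  module _ (u : Sequence L) where

    d-< : ∀ {c l} j k .(p : k + j <ᴸ L) → k + j < l → AllBelow u c k l → d u j k p < c
    d-< {l = l} zero k p k+0<l u<c = u<c k _ ≤-refl (subst (_< l) (+-identityʳ k) k+0<l)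
    d-< {l = l} (suc j) k p q u<c = ∣-∣-< _ _
      (d-< j (suc k) (<ᴸ-right k j p) q′ (λ i i<L k<i → u<c i i<L (<⇒≤ k<i)))
      (d-< j k (<ᴸ-left k j p) (<-trans (n<1+n _) q′) u<c)
      where
      q′ : suc k + j < l
      q′ = subst (_< l) (+-suc k j) q

    -- The right parent stands over zeros only, so each step up copies the left parent, starting
    -- from `u k`.
    d-headed : ∀ {l} j k .(p : k + j <ᴸ L) .(k<L : k <ᴸ L) → k + j < l →
               AllZero u (suc k) l → d u j k p ≡ u k k<L
    d-headed zero k p k<L q u≡0 = refl
    d-headed {l} (suc j) k p k<L q u≡0 = begin
      ∣ d u j (suc k) _ - d u j k _ ∣  ≡⟨ cong₂ ∣_-_∣ right≡0 left≡uₖ ⟩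
      u k _                            ∎
      where
      open ≡-Reasoning
      q′ : suc k + j < l
      q′ = subst (_< l) (+-suc k j) q

      -- Vanishing is being below 1, so `d-<` applies with bound 1.
      right≡0 : d u j (suc k) (<ᴸ-right k j p) ≡ 0
      right≡0 = n<1⇒n≡0 (d-< j (suc k) (<ᴸ-right k j p) q′
        (λ i i<L k<i i<l → subst (_< 1) (sym (u≡0 i i<L k<i i<l)) z<s))

      left≡uₖ : d u j k (<ᴸ-left k j p) ≡ u k k<L
      left≡uₖ = d-headed j k (<ᴸ-left k j p) k<L (<-trans (n<1+n _) q′) u≡0

    -- Induction along the right edge `k + j ≡ n`: the right parent stays on it and again reaches
    -- `c`, so the terms strictly between `k` and `n` vanish. Then `d-headed` identifies the left
    -- parent, which is 0, with `u k`.
    d-extremal⇒zero : ∀ {c n} j k .(p : k + j <ᴸ L) → k + j ≡ n →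
                      AllBelow u c k n → AllBelow u (suc c) k (suc n) →
                      c ≤ d u j k p → AllZero u k n
    d-extremal⇒zero zero k p refl u<c u≤c c≤d i i<L k≤i i<n =
      contradiction k≤i (<⇒≱ (subst (i <_) (+-identityʳ k) i<n))
    d-extremal⇒zero {c} {n} (suc j) k p k+1+j≡n u<c u≤c c≤d =
      conclude (∣-∣-extremal _ _ right≤c left<c c≤d)
      where
      1+k+j≡n : suc k + j ≡ n
      1+k+j≡n = trans (sym (+-suc k j)) k+1+j≡n

      u≤c′ : AllBelow u (suc c) (suc k) (suc n)
      u≤c′ i i<L k<i = u≤c i i<L (<⇒≤ k<i)

      right≤c : d u j (suc k) (<ᴸ-right k j p) ≤ c
      right≤c = s≤s⁻¹ (d-< j (suc k) (<ᴸ-right k j p) (s≤s (≤-reflexive 1+k+j≡n)) u≤c′)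

      left<c : d u j k (<ᴸ-left k j p) < c
      left<c = d-< j k (<ᴸ-left k j p) (≤-reflexive 1+k+j≡n) u<c

      conclude : c ≤ d u j (suc k) (<ᴸ-right k j p) × d u j k (<ᴸ-left k j p) ≡ 0 →
                 AllZero u k n
      conclude (c≤right , left≡0) i i<L k≤i i<n = by-cases (m≤n⇒m<n∨m≡n k≤i)
        where
        tail : AllZero u (suc k) n
        tail = d-extremal⇒zero j (suc k) (<ᴸ-right k j p) 1+k+j≡n
          (λ i i<L k<i → u<c i i<L (<⇒≤ k<i)) u≤c′ c≤right

        by-cases : k < i ⊎ k ≡ i → u i i<L ≡ 0
        by-cases (inj₁ k<i)  = tail i i<L k<i i<n
        by-cases (inj₂ refl) = trans
          (sym (d-headed j k (<ᴸ-left k j p) i<L (≤-reflexive 1+k+j≡n) tail)) left≡0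

  Υ-AllBelow : ∀ {c l} (u : Sequence L) → AllBelow u c 0 l → AllBelow (Υ u) c 0 l
  Υ-AllBelow u u<c i i<L _ i<l = d-< u i 0 i<L i<l u<c

  Υ^-AllBelow : ∀ {c l} m (u : Sequence L) → AllBelow u c 0 l → AllBelow (Υ^ m u) c 0 l
  Υ^-AllBelow zero    u u<c = u<c
  Υ^-AllBelow (suc m) u u<c = Υ-AllBelow (Υ^ m u) (Υ^-AllBelow m u u<c)

  AllBelow-snoc : ∀ {c n} (u : Sequence L) .(n<L : n <ᴸ L) →
                  AllBelow u c 0 n → u n n<L < c → AllBelow u c 0 (suc n)
  AllBelow-snoc u n<L u<c uₙ<c i i<L 0≤i (s≤s i≤n) with m≤n⇒m<n∨m≡n i≤n
  ... | inj₁ i<n  = u<c i i<L 0≤i i<n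
  ... | inj₂ refl = uₙ<c

  champion⇒zero-before : ∀ m (u : Sequence L) → Υ^ m (Υ u) ≈ u →
                         ∀ n .(n<L : n <ᴸ L) → Champion u n n<L → AllZero u 0 n
  champion⇒zero-before m u periodic n n<L (_ , champ) =
    d-extremal⇒zero u n 0 n<L refl u<c
      (AllBelow-snoc u n<L (λ i i<L 0≤i i<n → m<n⇒m<1+n (u<c i i<L 0≤i i<n)) ≤-refl)
      (≮⇒≥ Υuₙ≮c)
    where
    u<c : AllBelow u (u n n<L) 0 n
    u<c i i<L _ i<n = champ i i<L i<n

    -- Otherwise `Υ u` is below `c = u n` up to and including `n`. The remaining `m` applications
    -- keep this, and `periodic` then yields `c < c`.
    Υuₙ≮c : ¬ Υ u n n<L < u n n<L
    Υuₙ≮c Υuₙ<c = <-irrefl (periodic n n<L)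
      (Υ^-AllBelow m (Υ u) (AllBelow-snoc (Υ u) n<L (Υ-AllBelow u u<c) Υuₙ<c)
        n n<L z≤n ≤-refl)

  no-earlier-champion : ∀ m (u : Sequence L) → Υ^ m (Υ u) ≈ u →
                        ∀ i n .(i<L : i <ᴸ L) .(n<L : n <ᴸ L) →
                        Champion u i i<L → Champion u n n<L → ¬ i < n
  no-earlier-champion m u periodic i n i<L n<L (uᵢ>0 , _) champₙ i<n =
    >⇒≢ uᵢ>0 (champion⇒zero-before m u periodic n n<L champₙ i i<L z≤n i<n)

theorem2p4 : (L : Length) (u : Sequence L) → Υ^ 6 u ≈ u → AtMostOneChampion u
theorem2p4 L u periodic m n m<L n<L champₘ champₙ with <-cmp m n
-- `Υ^ 6 u` and `Υ^ 5 (Υ u)` unfold to the same term, so `periodic` fits with 5.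
... | tri< m<n _ _ = ⊥-elim (no-earlier-champion 5 u periodic m n m<L n<L champₘ champₙ m<n)
... | tri≈ _ m≡n _ = m≡n
... | tri> _ _ n<m = ⊥-elim (no-earlier-champion 5 u periodic n m n<L m<L champₙ champₘ n<m)
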